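{- Let $q$ be a prime power (even or odd). The weight-distribution bound is tight for the negative non-principal eigenvalue $-(q+1)$ of $Sp(4,q)$; that is, there exists an eigenfunction of $Sp(4,q)$ corresponding to the eigenvalue $-(q+1)$ that has exactly $2(q+1)$ non-zero values.
   Context: The graph $Sp(4,q)$ has the points of $\mathrm{PG}(3,q)$ as vertices, two distinct points $x,y$ being adjacent iff $y\in x^\zeta$, where $\zeta$ is a given symplectic polarity of $\mathrm{PG}(3,q)$ (a polarity with $x\in x^\zeta$ for every point $x$). It is a primitive strongly regular graph with eigenvalues $q(q+1)$ (principal), $q-1$ and $-(q+1)$. For a graph $G$ with eigenvalue $\theta$, a real-valued function $f\not\equiv 0$ on its vertex set is an eigenfunction corresponding to $\theta$ if $\theta f(u)=\sum_{w\in G(u)}f(w)$ for every vertex $u$, where $G(u)$ is the set of neighbours of $u$. The weight-distribution bound for a primitive strongly regular graph with non-principal eigenvalues $s<0<r$ states that an eigenfunction corresponding to $s$ has at least $-2s$ non-zeroes (and one corresponding to $r$ has at least $2(r+1)$ non-zeroes). The bound is tight for an eigenvalue if some eigenfunction corresponding to that eigenvalue attains it with equality. -}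

module Defs where

open import Algebra.Apartness.Bundles using (HeytingField)
open import Data.Fin.Base using (Fin)
import Data.Fin.Properties as Fin
open import Data.Integer.Base as ℤ using (ℤ; +_)
open import Data.List.Base using (List; foldr; map; length)
import Data.List.Membership.Setoid as Membership
import Data.List.Relation.Unary.Unique.Setoid as Uniqueness
open import Data.Nat.Base as ℕ using (ℕ)
import Data.Nat.Properties as ℕ
open import Data.Nat.Primality using (Prime)
open import Data.Product.Base using (Σ-syntax; ∃-syntax; _×_; _,_; proj₂)
open import Data.Rational.Base as ℚ using (ℚ; 0ℚ; 1ℚ; ½; Positive; ∣_∣)
import Data.Rational.Properties as ℚ
open import Data.Rational.Solver using (module +-*-Solver)
open import Data.Vec.Functional using (Vector)
import Data.Vec.Functional.Relation.Binary.Equality.Setoid as VecEquality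
open import Function.Bundles using (Func; Inverse; _⇔_)
open import Level using (Level; 0ℓ; _⊔_; suc)
open import Relation.Binary.Bundles using (Setoid)
open import Relation.Binary.Core using (Rel)
open import Relation.Binary.Definitions
  using (Decidable; Irreflexive; Symmetric; _Respects_; _Respects₂_)
import Relation.Binary.PropositionalEquality as ≡
open ≡ using (_≡_)
open import Relation.Nullary.Decidable using (map′)
open import Relation.Nullary.Negation using (¬_)
open import Relation.Unary as Pred using (Pred; _∈_; _⊆_; _≐_)

private
  variable
    a b c v ℓ ℓ₁ ℓ₂ e : Level

IsPrimePower : ℕ → Set
IsPrimePower q = ∃[ p ] ∃[ k ] (Prime p × 1 ℕ.≤ k × q ≡ p ℕ.^ k)

IsCauchy : (ℕ → ℚ) → Set
IsCauchy x = ∀ ε → Positive ε →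
  ∃[ N ] (∀ m n → N ℕ.≤ m → N ℕ.≤ n → ∣ x m ℚ.- x n ∣ ℚ.≤ ε)

record ℝ : Set where
  constructor mkℝ
  field
    seq    : ℕ → ℚ
    cauchy : IsCauchy seq

open ℝ public

infix  4 _≈ʳ_
infixl 6 _+ʳ_
infixl 7 _*ʳ_

_≈ʳ_ : Rel ℝ 0ℓ
x ≈ʳ y = ∀ ε → Positive ε →
  ∃[ N ] (∀ n → N ℕ.≤ n → ∣ seq x n ℚ.- seq y n ∣ ℚ.≤ ε)

private
  open +-*-Solver using (solve; _:+_; _:-_; _:*_; _:=_)

  ½-pos : ∀ ε → Positive ε → Positive (½ ℚ.* ε)
  ½-pos ε ε>0 = ℚ.pos*pos⇒pos ½ ε {{ε>0}}

  ½+½ : ∀ ε → ½ ℚ.* ε ℚ.+ ½ ℚ.* ε ≡ ε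
  ½+½ ε = ≡.trans (≡.sym (ℚ.*-distribʳ-+ ε ½ ½)) (ℚ.*-identityˡ ε)

  split : ∀ {s} t u ε → s ≡ t ℚ.+ u →
          ∣ t ∣ ℚ.≤ ½ ℚ.* ε → ∣ u ∣ ℚ.≤ ½ ℚ.* ε → ∣ s ∣ ℚ.≤ ε
  split t u ε ≡.refl t≤ u≤ =
    ℚ.≤-trans (ℚ.∣p+q∣≤∣p∣+∣q∣ t u)
      (ℚ.≤-trans (ℚ.+-mono-≤ t≤ u≤) (ℚ.≤-reflexive (½+½ ε)))

  ∣p-p∣≤ : ∀ p ε → Positive ε → ∣ p ℚ.- p ∣ ℚ.≤ ε
  ∣p-p∣≤ p ε ε>0 = ≡.subst (λ z → ∣ z ∣ ℚ.≤ ε) (≡.sym (ℚ.+-inverseʳ p))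
    (ℚ.<⇒≤ (ℚ.positive⁻¹ ε {{ε>0}}))

  ∣p-q∣≡∣q-p∣ : ∀ p q → ∣ p ℚ.- q ∣ ≡ ∣ q ℚ.- p ∣
  ∣p-q∣≡∣q-p∣ p q = ≡.trans (≡.sym (ℚ.∣-p∣≡∣p∣ (p ℚ.- q)))
    (≡.cong ∣_∣ (solve 2 (λ x y → +-*-Solver.:- (x :- y) := y :- x) ≡.refl p q))

  bounded : ∀ {x} → IsCauchy x →
    Σ[ B ∈ ℚ ] (Positive B × ∃[ N ] (∀ n → N ℕ.≤ n → ∣ x n ∣ ℚ.≤ B))
  bounded {x} cx with cx 1ℚ _
  ... | N , close = 1ℚ ℚ.+ ∣ x N ∣ , B>0 , N , bound
    where
    B>0 : Positive (1ℚ ℚ.+ ∣ x N ∣)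
    B>0 = ℚ.pos+nonNeg⇒pos 1ℚ ∣ x N ∣ {{ℚ.∣-∣-nonNeg (x N)}}
    bound : ∀ n → N ℕ.≤ n → ∣ x n ∣ ℚ.≤ 1ℚ ℚ.+ ∣ x N ∣
    bound n N≤n = ≡.subst (λ z → ∣ z ∣ ℚ.≤ 1ℚ ℚ.+ ∣ x N ∣)
      (solve 2 (λ s t → (s :- t) :+ t := s) ≡.refl (x n) (x N))
      (ℚ.≤-trans (ℚ.∣p+q∣≤∣p∣+∣q∣ (x n ℚ.- x N) (x N))
        (ℚ.+-monoˡ-≤ ∣ x N ∣ (close n N N≤n ℕ.≤-refl)))

  shrink : ∀ B ε → Positive B → Positive ε →
    Σ[ δ ∈ ℚ ] (Positive δ × B ℚ.* δ ≡ ½ ℚ.* ε)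
  shrink B ε B>0 ε>0 = B⁻¹ ℚ.* (½ ℚ.* ε)
    , ℚ.pos*pos⇒pos B⁻¹ {{ℚ.1/pos⇒pos B {{B>0}}}} (½ ℚ.* ε) {{½-pos ε ε>0}}
    , ≡.trans (≡.sym (ℚ.*-assoc B B⁻¹ (½ ℚ.* ε)))
        (≡.trans (≡.cong (ℚ._* (½ ℚ.* ε)) (ℚ.*-inverseʳ B {{B≢0}}))
          (ℚ.*-identityˡ (½ ℚ.* ε)))
    where
    B≢0 : ℚ.NonZero B
    B≢0 = ℚ.pos⇒nonZero B {{B>0}}
    B⁻¹ : ℚ
    B⁻¹ = ℚ.1/_ B {{B≢0}}

  ∣*∣-mono : ∀ p q B δ → Positive B → ∣ p ∣ ℚ.≤ B → ∣ q ∣ ℚ.≤ δ →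
             ∣ p ℚ.* q ∣ ℚ.≤ B ℚ.* δ
  ∣*∣-mono p q B δ B>0 p≤ q≤ =
    ℚ.≤-trans (ℚ.≤-reflexive (ℚ.∣p*q∣≡∣p∣*∣q∣ p q))
      (ℚ.≤-trans (ℚ.*-monoʳ-≤-nonNeg ∣ q ∣ {{ℚ.∣-∣-nonNeg q}} p≤)
        (ℚ.*-monoˡ-≤-nonNeg B {{ℚ.pos⇒nonNeg B {{B>0}}}} q≤))

ℝ-setoid : Setoid 0ℓ 0ℓ
ℝ-setoid = record
  { Carrier       = ℝ
  ; _≈_           = _≈ʳ_
  ; isEquivalence = record
    { refl  = λ {x} ε ε>0 → 0 , λ n _ → ∣p-p∣≤ (seq x n) ε ε>0
    ; sym   = λ {x} {y} x≈y ε ε>0 → let N , close = x≈y ε ε>0 in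
        N , λ n N≤n → ≡.subst (ℚ._≤ ε) (∣p-q∣≡∣q-p∣ (seq x n) (seq y n)) (close n N≤n)
    ; trans = λ {x} {y} {z} x≈y y≈z ε ε>0 →
        let M , close₁ = x≈y (½ ℚ.* ε) (½-pos ε ε>0)
            N , close₂ = y≈z (½ ℚ.* ε) (½-pos ε ε>0)
        in M ℕ.⊔ N , λ n le →
          split (seq x n ℚ.- seq y n) (seq y n ℚ.- seq z n) ε
            (solve 3 (λ p q r → p :- r := (p :- q) :+ (q :- r)) ≡.refl
              (seq x n) (seq y n) (seq z n))
            (close₁ n (ℕ.m⊔n≤o⇒m≤o M N le))
            (close₂ n (ℕ.m⊔n≤o⇒n≤o M N le))
    }
  }

fromℚ : ℚ → ℝ
fromℚ p = mkℝ (λ _ → p) (λ ε ε>0 → 0 , λ _ _ _ _ → ∣p-p∣≤ p ε ε>0)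

fromℤ : ℤ → ℝ
fromℤ i = fromℚ (i ℚ./ 1)

0ʳ : ℝ
0ʳ = fromℚ 0ℚ

_+ʳ_ : ℝ → ℝ → ℝ
mkℝ x cx +ʳ mkℝ y cy = mkℝ (λ n → x n ℚ.+ y n) λ ε ε>0 →
  let M , close₁ = cx (½ ℚ.* ε) (½-pos ε ε>0)
      N , close₂ = cy (½ ℚ.* ε) (½-pos ε ε>0)
  in M ℕ.⊔ N , λ m n le₁ le₂ →
    split (x m ℚ.- x n) (y m ℚ.- y n) ε
      (solve 4 (λ p q r s → (p :+ q) :- (r :+ s) := (p :- r) :+ (q :- s)) ≡.refl
        (x m) (y m) (x n) (y n))
      (close₁ m n (ℕ.m⊔n≤o⇒m≤o M N le₁) (ℕ.m⊔n≤o⇒m≤o M N le₂))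
      (close₂ m n (ℕ.m⊔n≤o⇒n≤o M N le₁) (ℕ.m⊔n≤o⇒n≤o M N le₂))

_*ʳ_ : ℝ → ℝ → ℝ
mkℝ x cx *ʳ mkℝ y cy = mkℝ (λ n → x n ℚ.* y n) λ ε ε>0 →
  let A , A>0 , K , x≤A = bounded cx
      B , B>0 , L , y≤B = bounded cy
      α , α>0 , Aα≡     = shrink A ε A>0 ε>0
      β , β>0 , Bβ≡     = shrink B ε B>0 ε>0
      M , close₁        = cy α α>0
      N , close₂        = cx β β>0
  in (K ℕ.⊔ L) ℕ.⊔ (M ℕ.⊔ N) , λ m n le₁ le₂ →
    let KL≤m = ℕ.m⊔n≤o⇒m≤o (K ℕ.⊔ L) (M ℕ.⊔ N) le₁
        KL≤n = ℕ.m⊔n≤o⇒m≤o (K ℕ.⊔ L) (M ℕ.⊔ N) le₂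
        MN≤m = ℕ.m⊔n≤o⇒n≤o (K ℕ.⊔ L) (M ℕ.⊔ N) le₁
        MN≤n = ℕ.m⊔n≤o⇒n≤o (K ℕ.⊔ L) (M ℕ.⊔ N) le₂
    in split (x m ℚ.* (y m ℚ.- y n)) (y n ℚ.* (x m ℚ.- x n)) ε
      (solve 4 (λ p q r s → p :* q :- r :* s := p :* (q :- s) :+ s :* (p :- r)) ≡.refl
        (x m) (y m) (x n) (y n))
      (ℚ.≤-trans
        (∣*∣-mono (x m) (y m ℚ.- y n) A α A>0
          (x≤A m (ℕ.m⊔n≤o⇒m≤o K L KL≤m))
          (close₁ m n (ℕ.m⊔n≤o⇒m≤o M N MN≤m) (ℕ.m⊔n≤o⇒m≤o M N MN≤n)))
        (ℚ.≤-reflexive Aα≡))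
      (ℚ.≤-trans
        (∣*∣-mono (y n) (x m ℚ.- x n) B β B>0
          (y≤B n (ℕ.m⊔n≤o⇒n≤o K L KL≤n))
          (close₂ m n (ℕ.m⊔n≤o⇒n≤o M N MN≤m) (ℕ.m⊔n≤o⇒n≤o M N MN≤n)))
        (ℚ.≤-reflexive Bβ≡))

sumʳ : List ℝ → ℝ
sumʳ = foldr _+ʳ_ 0ʳ

module _ (S : Setoid a ℓ) where
  private module S = Setoid S
  open Membership S using () renaming (_∈_ to _∈ₗ_)
  open Uniqueness S using (Unique)

  Enumerates : Pred S.Carrier b → List S.Carrier → Set (a ⊔ ℓ ⊔ b)
  Enumerates P xs = Unique xs × (∀ x → x ∈ₗ xs ⇔ P x)

  HasSize : Pred S.Carrier b → ℕ → Set (a ⊔ ℓ ⊔ b)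
  HasSize P n = ∃[ xs ] (Enumerates P xs × length xs ≡ n)

  -- P is finite and the sum of f over P is s; since f respects the
  -- equality of S, the choice of enumeration is immaterial.
  HasSum : Pred S.Carrier b → Func S ℝ-setoid → ℝ → Set (a ⊔ ℓ ⊔ b)
  HasSum P f s = ∃[ xs ] (Enumerates P xs × sumʳ (map (Func.to f) xs) ≈ʳ s)

record Graph (v ℓ e : Level) : Set (suc (v ⊔ ℓ ⊔ e)) where
  field
    vertices : Setoid v ℓ

  open Setoid vertices public using () renaming (Carrier to Vertex; _≈_ to _≈ᵥ_)

  field
    _~_      : Rel Vertex e
    ~-resp   : _~_ Respects₂ _≈ᵥ_
    ~-sym    : Symmetric _~_
    ~-irrefl : Irreflexive _≈ᵥ_ _~_

module _ (G : Graph v ℓ e) where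
  open Graph G

  VertexFunction : Set (v ⊔ ℓ)
  VertexFunction = Func vertices ℝ-setoid

  IsEigenfunction : ℝ → VertexFunction → Set (v ⊔ ℓ ⊔ e)
  IsEigenfunction θ f =
      ¬ (∀ u → Func.to f u ≈ʳ 0ʳ)
    × (∀ u → HasSum vertices (u ~_) f (θ *ʳ Func.to f u))

  HasNonZeroes : VertexFunction → ℕ → Set (v ⊔ ℓ)
  HasNonZeroes f = HasSize vertices (λ u → ¬ (Func.to f u ≈ʳ 0ʳ))

FiniteFieldOfOrder : HeytingField c ℓ₁ ℓ₂ → ℕ → Set (c ⊔ ℓ₁)
FiniteFieldOfOrder F q = Inverse (HeytingField.setoid F) (≡.setoid (Fin q))

module PG3 (F : HeytingField c ℓ₁ ℓ₂) {q : ℕ} (order : FiniteFieldOfOrder F q) where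
  private
    module F = HeytingField F
    module I = Inverse order
  open VecEquality F.setoid public using (_≋_; ≋-refl; ≋-sym; ≋-trans)

  V : Set c
  V = Vector F.Carrier 4

  infixl 6 _+ᵛ_
  infixr 7 _·_

  0ᵛ : V
  0ᵛ _ = F.0#

  _+ᵛ_ : V → V → V
  (x +ᵛ y) i = x i F.+ y i

  _·_ : F.Carrier → V → V
  (k · x) i = k F.* x i

  -- A subset of the finite set V, in the classical sense, is a decidable
  -- predicate.  The zero subspace and V itself are included: they
  -- are the empty subspace and the whole space of PG(3,q).
  record Subspace : Set (suc (c ⊔ ℓ₁)) where
    field
      Member   : Pred V (c ⊔ ℓ₁)
      member?  : Pred.Decidable Member
      resp     : Member Respects _≋_
      0-closed : 0ᵛ ∈ Member
      +-closed : ∀ {x y} → x ∈ Member → y ∈ Member → x +ᵛ y ∈ Member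
      ·-closed : ∀ k {x} → x ∈ Member → k · x ∈ Member

  open Subspace public using (Member)

  infix 4 _≤ˢ_ _≈ˢ_

  _≤ˢ_ : Rel Subspace (c ⊔ ℓ₁)
  U ≤ˢ W = Member U ⊆ Member W

  _≈ˢ_ : Rel Subspace (c ⊔ ℓ₁)
  U ≈ˢ W = Member U ≐ Member W

  _≟_ : Decidable F._≈_
  x ≟ y = map′
    (λ tx≡ty → F.trans (F.sym (I.strictlyInverseʳ x)) (I.inverseʳ tx≡ty))
    I.to-cong
    (I.to x Fin.≟ I.to y)

  _≟ᵛ_ : Decidable (_≋_ {4})
  x ≟ᵛ y = Fin.all? (λ i → x i ≟ y i)

  multiple? : ∀ x → Pred.Decidable (λ y → ∃[ k ] y ≋ k · x)
  multiple? x y = map′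
    (λ (i , y≋) → I.from i , y≋)
    (λ (k , y≋) → I.to k ,
      ≋-trans y≋ (λ j → F.*-congʳ (F.sym (I.strictlyInverseʳ k))))
    (Fin.any? (λ i → y ≟ᵛ (I.from i · x)))

  ⟨_⟩ : V → Subspace
  ⟨ x ⟩ = record
    { Member   = λ y → ∃[ k ] y ≋ k · x
    ; member?  = multiple? x
    ; resp     = λ y≋z (k , y≋) → k , ≋-trans (≋-sym y≋z) y≋
    ; 0-closed = F.0# , λ i → F.sym (F.zeroˡ (x i))
    ; +-closed = λ (k , y≋) (l , z≋) → k F.+ l ,
        λ i → F.trans (F.+-cong (y≋ i) (z≋ i)) (F.sym (F.distribʳ (x i) k l))
    ; ·-closed = λ m (k , y≋) → m F.* k ,
        λ i → F.trans (F.*-congˡ (y≋ i)) (F.sym (F.*-assoc m k (x i)))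
    }

  -- Homogeneous coordinates; the setoid points below identifies
  -- proportional ones.
  record Point : Set (c ⊔ ℓ₁) where
    constructor point
    field
      coords  : V
      nonzero : ¬ (coords ≋ 0ᵛ)

  open Point public

  span : Point → Subspace
  span x = ⟨ coords x ⟩

  points : Setoid (c ⊔ ℓ₁) (c ⊔ ℓ₁)
  points = record
    { Carrier       = Point
    ; _≈_           = λ x y → span x ≈ˢ span y
    ; isEquivalence = record
      { refl  = (λ z∈ → z∈) , (λ z∈ → z∈)
      ; sym   = λ (x≤y , y≤x) → y≤x , x≤y
      ; trans = λ (x≤y , y≤x) (y≤z , z≤y) → (λ w∈ → y≤z (x≤y w∈)) , (λ w∈ → y≤x (z≤y w∈))
      }
    }

  infix 4 _on_

  _on_ : Point → Subspace → Set (c ⊔ ℓ₁)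
  x on U = coords x ∈ Member U

  x∈⟨x⟩ : ∀ x → x ∈ Member ⟨ x ⟩
  x∈⟨x⟩ x = F.1# , λ i → F.sym (F.*-identityˡ (x i))

  on⇒≤ : ∀ {x} U → x on U → span x ≤ˢ U
  on⇒≤ U x∈U (k , y≋) = Subspace.resp U (≋-sym y≋) (Subspace.·-closed U k x∈U)

  -- An inclusion-reversing involution of the lattice of subspaces; that it
  -- is a bijection, and that it interchanges points and planes, follows.
  record Polarity : Set (suc (c ⊔ ℓ₁)) where
    field
      ζ          : Subspace → Subspace
      reversing  : ∀ {U W} → U ≤ˢ W → ζ W ≤ˢ ζ U
      involutive : ∀ U → ζ (ζ U) ≈ˢ U

  IsSymplectic : Polarity → Set (c ⊔ ℓ₁)
  IsSymplectic P = ∀ x → x on Polarity.ζ P (span x)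

  -- Symmetry of adjacency holds for every polarity, so the graph is
  -- defined without assuming that the polarity is symplectic.
  Sp4 : Polarity → Graph (c ⊔ ℓ₁) (c ⊔ ℓ₁) (c ⊔ ℓ₁)
  Sp4 P = record
    { vertices = points
    ; _~_      = λ x y → ¬ (x ≈ y) × y on ζ (span x)
    ; ~-resp   =
        (λ {x} {y} {z} y≈z (x≉y , y∈) →
            (λ x≈z → x≉y (≈-trans {x} {z} {y} x≈z (≈-sym {y} {z} y≈z)))
          , on⇒≤ {y} (ζ (span x)) y∈ (proj₂ y≈z (x∈⟨x⟩ (coords z))))
      , (λ {x} {y} {z} y≈z (y≉x , x∈) →
            (λ z≈x → y≉x (≈-trans {y} {z} {x} y≈z z≈x))
          , reversing (proj₂ y≈z) x∈)
    ; ~-sym    = λ {x} {y} (x≉y , y∈) →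
          (λ y≈x → x≉y (≈-sym {y} {x} y≈x))
        , reversing (on⇒≤ {y} (ζ (span x)) y∈)
            (proj₂ (involutive (span x)) (x∈⟨x⟩ (coords x)))
    ; ~-irrefl = λ x≈y (x≉y , _) → x≉y x≈y
    }
    where
    open Polarity P
    open Setoid points using (_≈_) renaming (sym to ≈-sym; trans to ≈-trans)

{-# OPTIONS --safe #-}

-- Write u ⊥ v for v ∈ ζ ⟨ u ⟩; since ζ reverses inclusions, ⊥ is symmetric and
-- linear in each argument.  Choose x, y with ¬ x ⊥ y.  The line L = ⟨ x , y ⟩
-- meets its polar ζ L trivially, so ζ L is again spanned by a non-orthogonal
-- pair.  Every point of L is adjacent to every point of ζ L, two points of the
-- same line are never adjacent, and a point on neither line is orthogonal to
-- exactly one point of each.  Hence the function that is 1 on L, -1 on ζ L and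
-- 0 elsewhere has eigenvalue -(q + 1).

module Submission where

open import Algebra.Apartness.Bundles using (HeytingField)
open import Data.Integer.Base using (+_; -_)
open import Data.Nat.Base using (ℕ; _+_; _*_)
open import Data.Product.Base using (∃-syntax; _×_)
open import Defs

open import Algebra.Apartness.Bundles using (HeytingCommutativeRing)
import Algebra.Apartness.Properties.HeytingCommutativeRing as HeytingProperties
open import Algebra.Bundles using (CommutativeRing)
import Algebra.Properties.AbelianGroup as AbelianGroupProperties
import Algebra.Properties.CommutativeSemigroup as CommutativeSemigroupProperties
import Algebra.Properties.Ring as RingProperties
open import Data.Empty using (⊥-elim)
open import Data.Fin.Base using (Fin; zero; suc; punchOut; combine; funToFin; finToFun)
open import Data.Fin.Patterns using (0F; 1F; 2F; 3F)
import Data.Fin.Properties as Fin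
open import Data.Integer.Base as ℤ using (ℤ; 0ℤ; 1ℤ; -1ℤ)
import Data.Integer.Properties as ℤ
open import Data.List.Base
  using (List; []; _∷_; _++_; map; length; filter; foldr; tabulate; deduplicate)
import Data.List.Membership.Setoid as Membership
import Data.List.Membership.Setoid.Properties as ∈ₗ
import Data.List.Properties as List
open import Data.List.Relation.Unary.All as All using (All; []; _∷_)
import Data.List.Relation.Unary.All.Properties as All
open import Data.List.Relation.Unary.AllPairs using ([]; _∷_)
open import Data.List.Relation.Unary.Any using (here; there)
import Data.List.Relation.Unary.Any.Properties as Any
import Data.List.Relation.Unary.Unique.DecSetoid.Properties as DecUnique
import Data.List.Relation.Unary.Unique.Setoid as Uniqueness
import Data.List.Relation.Unary.Unique.Setoid.Properties as Unique
open import Data.Nat.Base as ℕ using (s≤s; z≤n)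
open import Data.Nat.Primality using (prime⇒nonTrivial)
import Data.Nat.Properties as ℕ
open import Data.Product.Base using (_,_; proj₁; proj₂; map₂)
open import Data.Rational.Base as ℚ using (½; toℚᵘ; ∣_∣)
import Data.Rational.Properties as ℚ
open import Data.Rational.Unnormalised.Base as ℚᵘ using (mkℚᵘ; *≡*)
import Data.Rational.Unnormalised.Properties as ℚᵘ
open import Data.Sum.Base as Sum using (_⊎_; inj₁; inj₂; [_,_]′)
open import Function.Base using (_∘_)
open import Function.Bundles using (Func; Inverse; Equivalence; _⇔_; mk⇔)
open import Function.Definitions using (Injective)
open import Level using (_⊔_)
open import Relation.Binary.Bundles using (Setoid)
open import Relation.Binary.Definitions using (_Respects_) renaming (Decidable to Decidable₂)
open import Relation.Binary.PropositionalEquality as ≡ using (_≡_; _≢_; refl; cong)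
open import Relation.Nullary using (Dec; yes; no; ¬_; ¬?; _×-dec_; _⊎-dec_)
open import Relation.Nullary.Decidable using (map′; decidable-stable)
open import Relation.Unary using (Pred; Decidable; _∈_; _∉_)

-- Integers as real numbers

-- The polarity is given only as an involution of the subspace lattice: there is no bilinear form
-- and no dimension formula to draw on. Two facts that dimension would supply come from counting
-- instead. One is that ζ L is non-zero: otherwise L would be all of V, although q ^ 4 > q ^ 2 once
-- q > 1. The other is that ζ L is no larger than the span of a non-orthogonal pair chosen inside
-- it: with the pair spanning L this gives four independent vectors, and the injective map from
-- coefficient tuples to V must be onto. Both polars are then known exactly, ζ L = L′ and ζ L′ = L.
-- This is what gives uniqueness for a point u off both lines: two orthogonal points on one line
-- would put u on the polar of that line, which is the other line.

sumᶻ : List ℤ → ℤ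
sumᶻ = foldr ℤ._+_ 0ℤ

-- For a variable i the quotient `i / 1` is stuck on a gcd, so the equation is checked among
-- unnormalised rationals, where the denominators are plain ones.
/1-homo-+ : ∀ i j → i ℚ./ 1 ℚ.+ j ℚ./ 1 ≡ (i ℤ.+ j) ℚ./ 1
/1-homo-+ i j = ℚ.toℚᵘ-injective (begin-equality
  toℚᵘ (i ℚ./ 1 ℚ.+ j ℚ./ 1)           ≃⟨ ℚ.toℚᵘ-homo-+ (i ℚ./ 1) (j ℚ./ 1) ⟩
  toℚᵘ (i ℚ./ 1) ℚᵘ.+ toℚᵘ (j ℚ./ 1)   ≃⟨ ℚᵘ.+-cong (ℚ.toℚᵘ-fromℚᵘ (mkℚᵘ i 0)) (ℚ.toℚᵘ-fromℚᵘ (mkℚᵘ j 0)) ⟩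
  mkℚᵘ i 0 ℚᵘ.+ mkℚᵘ j 0
    ≃⟨ *≡* (cong (ℤ._* + 1) (≡.cong₂ ℤ._+_ (ℤ.*-identityʳ i) (ℤ.*-identityʳ j))) ⟩
  mkℚᵘ (i ℤ.+ j) 0                     ≃⟨ ℚ.toℚᵘ-fromℚᵘ (mkℚᵘ (i ℤ.+ j) 0) ⟨
  toℚᵘ ((i ℤ.+ j) ℚ./ 1)               ∎)
  where open ℚᵘ.≤-Reasoning

/1-homo-* : ∀ i j → i ℚ./ 1 ℚ.* (j ℚ./ 1) ≡ (i ℤ.* j) ℚ./ 1
/1-homo-* i j = ℚ.toℚᵘ-injective (begin-equality
  toℚᵘ (i ℚ./ 1 ℚ.* (j ℚ./ 1))         ≃⟨ ℚ.toℚᵘ-homo-* (i ℚ./ 1) (j ℚ./ 1) ⟩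
  toℚᵘ (i ℚ./ 1) ℚᵘ.* toℚᵘ (j ℚ./ 1)   ≃⟨ ℚᵘ.*-cong (ℚ.toℚᵘ-fromℚᵘ (mkℚᵘ i 0)) (ℚ.toℚᵘ-fromℚᵘ (mkℚᵘ j 0)) ⟩
  mkℚᵘ i 0 ℚᵘ.* mkℚᵘ j 0               ≃⟨ ℚ.toℚᵘ-fromℚᵘ (mkℚᵘ (i ℤ.* j) 0) ⟨
  toℚᵘ ((i ℤ.* j) ℚ./ 1)               ∎)
  where open ℚᵘ.≤-Reasoning

≡⇒≈ʳ : ∀ {x y} → (∀ n → seq x n ≡ seq y n) → x ≈ʳ y
≡⇒≈ʳ {x} {y} x≡y ε ε>0 = 0 , λ n _ →
  ≡.subst (λ z → ∣ seq x n ℚ.- z ∣ ℚ.≤ ε) (x≡y n)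
    (proj₂ (Setoid.refl ℝ-setoid {x} ε ε>0) n z≤n)

-- Only constant sequences occur, so equality holds term by term and every eigenvalue sum can be
-- evaluated in ℤ.
sumʳ-fromℤ : ∀ {a} {A : Set a} (g : A → ℤ) xs →
             sumʳ (map (fromℤ ∘ g) xs) ≈ʳ fromℤ (sumᶻ (map g xs))
sumʳ-fromℤ g xs = ≡⇒≈ʳ {sumʳ (map (fromℤ ∘ g) xs)} {fromℤ (sumᶻ (map g xs))} (pointwise xs)
  where
  pointwise : ∀ xs n → seq (sumʳ (map (fromℤ ∘ g) xs)) n ≡ sumᶻ (map g xs) ℚ./ 1
  pointwise []       n = refl
  pointwise (x ∷ xs) n = ≡.trans (cong (g x ℚ./ 1 ℚ.+_) (pointwise xs n)) (/1-homo-+ (g x) _)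

fromℤ-homo-* : ∀ i j → fromℤ i *ʳ fromℤ j ≈ʳ fromℤ (i ℤ.* j)
fromℤ-homo-* i j = ≡⇒≈ʳ {fromℤ i *ʳ fromℤ j} {fromℤ (i ℤ.* j)} (λ _ → /1-homo-* i j)

fromℤ-cong : ∀ {i j} → i ≡ j → fromℤ i ≈ʳ fromℤ j
fromℤ-cong {i} refl = Setoid.refl ℝ-setoid {fromℤ i}

1ʳ≉0 : ¬ fromℤ 1ℤ ≈ʳ 0ʳ
1ʳ≉0 1≈0 with 1≈0 ½ _
... | N , close with close N ℕ.≤-refl
... | ℚ.*≤* (ℤ.+≤+ (s≤s ()))

-1ʳ≉0 : ¬ fromℤ -1ℤ ≈ʳ 0ʳ
-1ʳ≉0 1≈0 with 1≈0 ½ _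
... | N , close with close N ℕ.≤-refl
... | ℚ.*≤* (ℤ.+≤+ (s≤s ()))

sum-const : ∀ {a} {A : Set a} (g : A → ℤ) k {xs} → All (λ x → g x ≡ k) xs →
            sumᶻ (map g xs) ≡ + length xs ℤ.* k
sum-const g k []                  = refl
sum-const g k {x ∷ xs} (eq ∷ eqs) = ≡.trans (≡.cong₂ ℤ._+_ eq (sum-const g k eqs))
  (≡.sym (ℤ.suc-* (+ length xs) k))

sum-append-zero : ∀ {a} {A : Set a} (g : A → ℤ) xs {ys} → sumᶻ (map g ys) ≡ 0ℤ →
                  sumᶻ (map g (xs ++ ys)) ≡ sumᶻ (map g xs)
sum-append-zero g []       eq = eq
sum-append-zero g (x ∷ xs) eq = cong (λ s → g x ℤ.+ s) (sum-append-zero g xs eq)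

-- Finite sums and the pigeonhole principle

module _ {a ℓ} (S : Setoid a ℓ) where
  open Setoid S using (Carrier; _≈_)
  open Membership S renaming (_∈_ to _∈ₗ_)

  -- The part of P outside Q contributes nothing, so only its existence as
  -- a list matters; it is cut out of an enumeration of the whole setoid.
  hasSum-extend : ∀ {p r} {P : Pred Carrier p} {Q : Pred Carrier r} →
    Decidable P → P Respects _≈_ → Decidable Q → Q Respects _≈_ →
    ∀ {all} → Uniqueness.Unique S all → (∀ x → x ∈ₗ all) →
    (f : Func S ℝ-setoid) (g : Carrier → ℤ) → (∀ x → Func.to f x ≡ fromℤ (g x)) →
    (∀ x → ¬ Q x → g x ≡ 0ℤ) →
    ∀ {xs} → Enumerates S (λ x → P x × Q x) xs →
    HasSum S P f (fromℤ (sumᶻ (map g xs)))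
  hasSum-extend {P = P} {Q} P? P-resp Q? Q-resp {all} all! ∈all f g f≡g g≡0 {xs} (xs! , xs⇔) =
    xs ++ rest , (Unique.++⁺ S xs! (Unique.filter⁺ S R? all!) disjoint , λ x → mk⇔ to from) , sum≈
    where
    R : Pred Carrier _
    R x = P x × ¬ Q x

    R? : Decidable R
    R? x = P? x ×-dec ¬? (Q? x)

    R-resp : R Respects _≈_
    R-resp x≈y (Px , ¬Qx) = P-resp x≈y Px , ¬Qx ∘ Q-resp (Setoid.sym S x≈y)

    rest : List Carrier
    rest = filter R? all

    disjoint : ∀ {x} → ¬ (x ∈ₗ xs × x ∈ₗ rest)
    disjoint {x} (x∈xs , x∈rest) =
      proj₂ (proj₂ (∈ₗ.∈-filter⁻ S R? R-resp {xs = all} x∈rest))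
        (proj₂ (Equivalence.to (xs⇔ x) x∈xs))

    to : ∀ {x} → x ∈ₗ xs ++ rest → P x
    to {x} x∈ = [ proj₁ ∘ Equivalence.to (xs⇔ x)
                , proj₁ ∘ proj₂ ∘ ∈ₗ.∈-filter⁻ S R? R-resp {xs = all}
                ]′ (∈ₗ.∈-++⁻ S xs x∈)

    from : ∀ {x} → P x → x ∈ₗ xs ++ rest
    from {x} Px with Q? x
    ... | yes Qx = ∈ₗ.∈-++⁺ˡ S (Equivalence.from (xs⇔ x) (Px , Qx))
    ... | no ¬Qx = ∈ₗ.∈-++⁺ʳ S xs
                     (∈ₗ.∈-filter⁺ S R? R-resp (∈all x) (Px , ¬Qx))

    rest≡0 : sumᶻ (map g rest) ≡ 0ℤ
    rest≡0 = ≡.trans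
      (sum-const g 0ℤ (All.map (λ {x} Rx → g≡0 x (proj₂ Rx)) (All.all-filter R? all)))
      (ℤ.*-zeroʳ (+ length rest))

    sum≈ : sumʳ (map (Func.to f) (xs ++ rest)) ≈ʳ fromℤ (sumᶻ (map g xs))
    sum≈ rewrite List.map-cong f≡g (xs ++ rest) | ≡.sym (sum-append-zero g xs rest≡0) =
      sumʳ-fromℤ g (xs ++ rest)

-- If j were missed, punching it out of the codomain would inject n + 1 elements into n.
injective⇒surjective : ∀ {n} {f : Fin n → Fin n} → Injective _≡_ _≡_ f → ∀ j → ∃[ i ] f i ≡ j
injective⇒surjective {ℕ.suc n} {f} inj j with Fin.any? (λ i → f i Fin.≟ j)
... | yes hit = hit
... | no miss = ⊥-elim (ℕ.1+n≰n (Fin.injective⇒≤ {f = λ i → punchOut (j≢f i)}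
                  (λ {i} {k} eq → inj (Fin.punchOut-injective (j≢f i) (j≢f k) eq))))
  where
  j≢f : ∀ i → j ≢ f i
  j≢f i j≡ = miss (i , ≡.sym j≡)

-- Linear algebra over a finite field

module Geometry {c ℓ₁ ℓ₂} (F : HeytingField c ℓ₁ ℓ₂) {q : ℕ} (order : FiniteFieldOfOrder F q) where
  open PG3 F order
  private
    module F = HeytingField F
    module I = Inverse order
    module R = CommutativeRing (HeytingCommutativeRing.commutativeRing F.heytingCommutativeRing)
    module FP = RingProperties R.ring
    module F+ = AbelianGroupProperties R.+-abelianGroup
    module F+ˢ = CommutativeSemigroupProperties R.+-commutativeSemigroup
  open F using (0#; 1#; _≈_) renaming (-_ to ⁻_)
  open import Relation.Binary.Reasoning.Setoid F.setoid

  from-to : ∀ k → I.from (I.to k) ≈ k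
  from-to = I.strictlyInverseʳ

  from-injective : ∀ {i j} → I.from i ≈ I.from j → i ≡ j
  from-injective {i} {j} eq =
    ≡.trans (≡.sym (I.strictlyInverseˡ i)) (≡.trans (I.to-cong eq) (I.strictlyInverseˡ j))

  1≉0 : ¬ 1# ≈ 0#
  1≉0 1≈0 = F.#-irrefl 1≈0 (HeytingProperties.1#0 F.heytingCommutativeRing)

  -- Non-zero only yields ¬ ¬ (k # 0), so the inverse is found by searching the field.
  inverse : ∀ k → ¬ k ≈ 0# → ∃[ h ] h F.* k ≈ 1#
  inverse k k≉0 with Fin.any? (λ i → (I.from i F.* k) ≟ 1#)
  ... | yes (i , ik≈1) = I.from i , ik≈1
  ... | no none = ⊥-elim (k≉0 (proj₁ (F.tight k 0#) k¬#0))
    where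
    k¬#0 : ¬ k F.# 0#
    k¬#0 k#0 with F.#⇒invertible k#0
    ... | h , h[k-0]≈1 , _ = none (I.to h , (begin
      I.from (I.to h) F.* k
        ≈⟨ F.*-cong (from-to h) (F.sym (HeytingProperties.x-0≈x F.heytingCommutativeRing k)) ⟩
      h F.* (k F.- 0#)        ≈⟨ h[k-0]≈1 ⟩
      1#                      ∎))

  +ᵛ-cong : ∀ {x x′ y y′} → x ≋ x′ → y ≋ y′ → x +ᵛ y ≋ x′ +ᵛ y′
  +ᵛ-cong x≋ y≋ i = F.+-cong (x≋ i) (y≋ i)

  ·-congʳ : ∀ {k l x} → k ≈ l → k · x ≋ l · x
  ·-congʳ k≈l i = F.*-congʳ k≈l

  +ᵛ-comm : ∀ x y → x +ᵛ y ≋ y +ᵛ x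
  +ᵛ-comm x y i = F.+-comm (x i) (y i)

  +ᵛ-cancelʳ : ∀ x y → (x +ᵛ y) +ᵛ (⁻ 1# · y) ≋ x
  +ᵛ-cancelʳ x y i = begin
    x i F.+ y i F.+ (⁻ 1# F.* y i) ≈⟨ F.+-congˡ (FP.-1*x≈-x (y i)) ⟩
    x i F.+ y i F.+ ⁻ y i          ≈⟨ F+.//-rightDividesʳ (y i) (x i) ⟩
    x i                            ∎

  0·x≋0 : ∀ {k x} → k ≈ 0# → k · x ≋ 0ᵛ
  0·x≋0 {x = x} k≈0 i = F.trans (F.*-congʳ k≈0) (F.zeroˡ (x i))

  -- Numbering the vectors of V

  vec : Fin (q ℕ.^ 4) → V
  vec n i = I.from (finToFun n i)

  code : V → Fin (q ℕ.^ 4)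
  code v = funToFin (I.to ∘ v)

  vec-code : ∀ v → vec (code v) ≋ v
  vec-code v i = F.trans (I.from-cong (Fin.finToFun-funToFin (I.to ∘ v) i)) (from-to (v i))

  funToFin-cong : ∀ {m n} {f g : Fin m → Fin n} → (∀ i → f i ≡ g i) → funToFin f ≡ funToFin g
  funToFin-cong {ℕ.zero}  f≡g = refl
  funToFin-cong {ℕ.suc m} f≡g = ≡.cong₂ combine (f≡g zero) (funToFin-cong (f≡g ∘ suc))

  vec-injective : ∀ {m n} → vec m ≋ vec n → m ≡ n
  vec-injective {m} {n} eq =
    ≡.trans (≡.sym (Fin.funToFin-finToFin {4} {q} m))
      (≡.trans (funToFin-cong (λ i → from-injective (eq i))) (Fin.funToFin-finToFin {4} {q} n))

  code-injective : ∀ {u v} → code u ≡ code v → u ≋ v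
  code-injective {u} {v} eq = ≋-trans (≋-sym (vec-code u))
    (≋-trans (λ i → F.reflexive (≡.cong (λ n → vec n i) eq)) (vec-code v))

  -- Subspaces

  ⟨⟩≤ : ∀ U {v} → v ∈ Member U → ⟨ v ⟩ ≤ˢ U
  ⟨⟩≤ U v∈U (k , y≋) = Subspace.resp U (≋-sym y≋) (Subspace.·-closed U k v∈U)

  zero∈ : ∀ U {v} → v ≋ 0ᵛ → v ∈ Member U
  zero∈ U v≋0 = Subspace.resp U (≋-sym v≋0) (Subspace.0-closed U)

  ∈-cancelʳ : ∀ U {x y} → x +ᵛ y ∈ Member U → y ∈ Member U → x ∈ Member U
  ∈-cancelʳ U {x} {y} x+y∈ y∈ = Subspace.resp U (+ᵛ-cancelʳ x y)
    (Subspace.+-closed U x+y∈ (Subspace.·-closed U (⁻ 1#) y∈))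

  ∈-cancelˡ : ∀ U {x y} → x +ᵛ y ∈ Member U → x ∈ Member U → y ∈ Member U
  ∈-cancelˡ U {x} {y} x+y∈ x∈ = ∈-cancelʳ U (Subspace.resp U (+ᵛ-comm x y) x+y∈) x∈

  ·-cancel : ∀ U {k v} → ¬ k ≈ 0# → k · v ∈ Member U → v ∈ Member U
  ·-cancel U {k} {v} k≉0 kv∈ with inverse k k≉0
  ... | h , hk≈1 = Subspace.resp U h·k·v≋v (Subspace.·-closed U h kv∈)
    where
    h·k·v≋v : h · (k · v) ≋ v
    h·k·v≋v i = F.trans (F.sym (F.*-assoc h k (v i)))
      (F.trans (F.*-congʳ hk≈1) (F.*-identityˡ (v i)))

  ∈⟨⟩-sym : ∀ {u v} → ¬ u ≋ 0ᵛ → u ∈ Member ⟨ v ⟩ → v ∈ Member ⟨ u ⟩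
  ∈⟨⟩-sym {u} {v} u≉0 (k , u≋kv) = ·-cancel ⟨ u ⟩ {k}
    (λ k≈0 → u≉0 (≋-trans u≋kv (0·x≋0 k≈0)))
    (Subspace.resp ⟨ u ⟩ u≋kv (x∈⟨x⟩ u))

  -- An exhaustive search of V: a failing inclusion yields an actual vector, which is how
  -- non-orthogonal vectors are chosen later.
  ≤ˢ-or-outside : ∀ U W → U ≤ˢ W ⊎ ∃[ v ] (v ∈ Member U × v ∉ Member W)
  ≤ˢ-or-outside U W
    with Fin.any? (λ n → Subspace.member? U (vec n) ×-dec ¬? (Subspace.member? W (vec n)))
  ... | yes (n , n∈U , n∉W) = inj₂ (vec n , n∈U , n∉W)
  ... | no  none = inj₁ λ {v} v∈U → decidable-stable (Subspace.member? W v) λ v∉W →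
    none (code v , Subspace.resp U (≋-sym (vec-code v)) v∈U , v∉W ∘ Subspace.resp W (vec-code v))

  infixl 6 _⊕_

  -- Membership quantifies over one scalar instead of a scalar and a vector of U, so it is decided
  -- by a search through F.
  _⊕_ : Subspace → V → Subspace
  U ⊕ x = record
    { Member   = λ v → ∃[ k ] v +ᵛ k · x ∈ Member U
    ; member?  = λ v → map′ (λ (i , v∈) → I.from i , v∈)
        (λ (k , v∈) → I.to k , U.resp (+ᵛ-cong (≋-refl {x = v}) (·-congʳ (F.sym (from-to k)))) v∈)
        (Fin.any? (λ i → U.member? (v +ᵛ I.from i · x)))
    ; resp     = λ v≋w (k , v∈) → k , U.resp (+ᵛ-cong v≋w (≋-refl {x = k · x})) v∈
    ; 0-closed = 0# , zero∈ U (λ i → F.trans (F.+-identityˡ _) (F.zeroˡ (x i)))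
    ; +-closed = λ {v} {w} (k , v∈) (l , w∈) → k F.+ l , U.resp
        (λ i → F.trans (F+ˢ.interchange (v i) (k F.* x i) (w i) (l F.* x i))
          (F.+-congˡ (F.sym (F.distribʳ (x i) k l))))
        (U.+-closed v∈ w∈)
    ; ·-closed = λ m {v} (k , v∈) → m F.* k , U.resp
        (λ i → F.trans (F.distribˡ m (v i) (k F.* x i)) (F.+-congˡ (F.sym (F.*-assoc m k (x i)))))
        (U.·-closed m v∈)
    }
    where module U = Subspace U

  ≤⊕ : ∀ U x → U ≤ˢ U ⊕ x
  ≤⊕ U x {v} v∈ = 0# , Subspace.+-closed U v∈ (zero∈ U (0·x≋0 {x = x} F.refl))

  ∈⊕ : ∀ U x → x ∈ Member (U ⊕ x)
  ∈⊕ U x = ⁻ 1# , zero∈ U (λ i →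
    F.trans (F.+-congˡ (FP.-1*x≈-x (x i))) (F.-‿inverseʳ (x i)))

  ⊕-least : ∀ U x W → U ≤ˢ W → x ∈ Member W → U ⊕ x ≤ˢ W
  ⊕-least U x W U≤W x∈W {v} (k , v+kx∈U) =
    ∈-cancelʳ W {v} {k · x} (U≤W v+kx∈U) (Subspace.·-closed W k x∈W)

  -- Orthogonality with respect to a symplectic polarity

  module Symplectic (P : Polarity) (symplectic : IsSymplectic P) where
    open Polarity P

    infix 4 _⊥_

    _⊥_ : V → V → Set (c ⊔ ℓ₁)
    u ⊥ v = v ∈ Member (ζ ⟨ u ⟩)

    ⊥-sym : ∀ {u v} → u ⊥ v → v ⊥ u
    ⊥-sym {u} {v} u⊥v = reversing {⟨ v ⟩} {ζ ⟨ u ⟩} (⟨⟩≤ (ζ ⟨ u ⟩) u⊥v)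
      (proj₂ (involutive ⟨ u ⟩) (x∈⟨x⟩ u))

    -- The hypothesis says U ≤ ζ ⟨ u ⟩; applying ζ gives ζ ζ ⟨ u ⟩ ≤ ζ U, and u lies in the left
    -- side.
    ∈ζ : ∀ U {u} → (∀ {v} → v ∈ Member U → u ⊥ v) → u ∈ Member (ζ U)
    ∈ζ U {u} u⊥U = reversing {U} {ζ ⟨ u ⟩} u⊥U (proj₂ (involutive ⟨ u ⟩) (x∈⟨x⟩ u))

    ζ⇒⊥ : ∀ U {u v} → u ∈ Member (ζ U) → v ∈ Member U → u ⊥ v
    ζ⇒⊥ U {u} {v} u∈ζU v∈U = ⊥-sym {v} {u} (reversing {⟨ v ⟩} {U} (⟨⟩≤ U v∈U) u∈ζU)

    0⊥ : ∀ {u v} → u ≋ 0ᵛ → u ⊥ v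
    0⊥ {u} {v} u≋0 = ⊥-sym {v} {u} (zero∈ (ζ ⟨ v ⟩) u≋0)

    ⊥-refl : ∀ u → u ⊥ u
    ⊥-refl u with u ≟ᵛ 0ᵛ
    ... | yes u≋0 = 0⊥ {u} {u} u≋0
    ... | no  u≉0 = symplectic (point u u≉0)

    -- The whole space is ζ ⟨ 0ᵛ ⟩.
    nondegenerate : ∀ {u} → (∀ v → u ⊥ v) → u ≋ 0ᵛ
    nondegenerate {u} u⊥ with proj₁ (involutive ⟨ 0ᵛ ⟩)
      (∈ζ (ζ ⟨ 0ᵛ ⟩) {u} (λ {v} _ → u⊥ v))
    ... | k , u≋k0 = ≋-trans u≋k0 (λ i → F.zeroʳ k)

    -- Every v is orthogonal to zero vectors, hence to all of ζ U, and so lies in ζ ζ U = U.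
    ζ-trivial⇒full : ∀ U → (∀ {w} → w ∈ Member (ζ U) → w ≋ 0ᵛ) → ∀ v → v ∈ Member U
    ζ-trivial⇒full U ζU≈0 v = proj₁ (involutive U)
      (∈ζ (ζ U) {v} (λ {w} w∈ → ⊥-sym {w} {v} (0⊥ {w} {v} (ζU≈0 w∈))))

    -- This replaces the statement that ζ ⟨ u ⟩ has codimension one. A vector of ζ W is a multiple
    -- of u and orthogonal to x; as u is not orthogonal to x, it is zero, so W is everything.
    hyperplane : ∀ {u x} → ¬ u ⊥ x → ∀ v → ∃[ k ] u ⊥ v +ᵛ k · x
    hyperplane {u} {x} u⊥̸x = ζ-trivial⇒full W ζW≈0
      where
      W : Subspace
      W = ζ ⟨ u ⟩ ⊕ x

      ζW≈0 : ∀ {w} → w ∈ Member (ζ W) → w ≋ 0ᵛ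
      ζW≈0 {w} w∈ with proj₁ (involutive ⟨ u ⟩) (reversing {ζ ⟨ u ⟩} {W} (≤⊕ (ζ ⟨ u ⟩) x) w∈)
      ... | k , w≋ku with k ≟ 0#
      ...   | yes k≈0 = ≋-trans w≋ku (0·x≋0 k≈0)
      ...   | no  k≉0 = ⊥-elim (u⊥̸x (⊥-sym {x} {u} (·-cancel (ζ ⟨ x ⟩) k≉0
        (Subspace.resp (ζ ⟨ x ⟩) w≋ku (⊥-sym {w} {x} (ζ⇒⊥ W {w} {x} w∈ (∈⊕ (ζ ⟨ u ⟩) x)))))))

    -- Pairing with z reads off the coefficient of x.
    coefficient : ∀ z {x a a′ w w′} → ¬ z ⊥ x → z ⊥ w → z ⊥ w′ →
                  a · x +ᵛ w ≋ a′ · x +ᵛ w′ → a ≈ a′ × w ≋ w′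
    coefficient z {x} {a} {a′} {w} {w′} z⊥̸x z⊥w z⊥w′ eq = a≈a′ , w≋w′
      where
      [a-a′]x+w≋w′ : (a F.- a′) · x +ᵛ w ≋ w′
      [a-a′]x+w≋w′ i = begin
        (a F.- a′) F.* x i F.+ w i
          ≈⟨ F.+-congʳ (FP.[y-z]x≈yx-zx (x i) a a′) ⟩
        a F.* x i F.- a′ F.* x i F.+ w i
          ≈⟨ F+ˢ.xy∙z≈xz∙y _ _ _ ⟩
        a F.* x i F.+ w i F.- a′ F.* x i
          ≈⟨ F.+-congʳ (eq i) ⟩
        a′ F.* x i F.+ w′ i F.- a′ F.* x i
          ≈⟨ F+.xyx⁻¹≈y _ _ ⟩
        w′ i ∎

      a≈a′ : a ≈ a′
      a≈a′ = decidable-stable (a ≟ a′) (λ a≉a′ → z⊥̸x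
        (·-cancel (ζ ⟨ z ⟩) {a F.- a′} (a≉a′ ∘ F+.x∙y⁻¹≈ε⇒x≈y a a′)
          (∈-cancelʳ (ζ ⟨ z ⟩) {(a F.- a′) · x} {w}
            (Subspace.resp (ζ ⟨ z ⟩) (≋-sym [a-a′]x+w≋w′) z⊥w′) z⊥w)))

      w≋w′ : w ≋ w′
      w≋w′ i = F+.∙-cancelˡ (a F.* x i) _ _
        (F.trans (eq i) (F.+-congʳ (F.*-congʳ (F.sym a≈a′))))

    -- The points of a hyperbolic line

    module HyperbolicPair {x y : V} (x⊥̸y : ¬ x ⊥ y) where

      line : Subspace
      line = ⟨ x ⟩ ⊕ y

      x∈line : x ∈ Member line
      x∈line = ≤⊕ ⟨ x ⟩ y (x∈⟨x⟩ x)

      y∈line : y ∈ Member line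
      y∈line = ∈⊕ ⟨ x ⟩ y

      y⊥̸x : ¬ y ⊥ x
      y⊥̸x = x⊥̸y ∘ ⊥-sym {y} {x}

      line≤ : ∀ U → x ∈ Member U → y ∈ Member U → line ≤ˢ U
      line≤ U x∈ y∈ = ⊕-least ⟨ x ⟩ y U (⟨⟩≤ U x∈) y∈

      ∈ζline : ∀ {u} → u ⊥ x → u ⊥ y → u ∈ Member (ζ line)
      ∈ζline {u} u⊥x u⊥y = ∈ζ line (line≤ (ζ ⟨ u ⟩) u⊥x u⊥y)

      -- One representative for each point of the line: x is the point at infinity and the other q
      -- have an affine parameter in F. This is the source of the number q + 1.
      pencil : Fin (ℕ.suc q) → V
      pencil zero    = x
      pencil (suc i) = I.from i · x +ᵛ y

      ⊥pencil⇒⊥y : ∀ {u} i → u ⊥ pencil (suc i) → u ⊥ x → u ⊥ y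
      ⊥pencil⇒⊥y {u} i u⊥p u⊥x =
        ∈-cancelˡ (ζ ⟨ u ⟩) u⊥p (Subspace.·-closed (ζ ⟨ u ⟩) (I.from i) u⊥x)

      pencil∈line : ∀ i → pencil i ∈ Member line
      pencil∈line zero    = x∈line
      pencil∈line (suc i) =
        Subspace.+-closed line (Subspace.·-closed line (I.from i) x∈line) y∈line

      -- Since x ⊥ x, orthogonality of x to i x + y would force x ⊥ y.
      pencil∉ζline : ∀ i → pencil i ∉ Member (ζ line)
      pencil∉ζline zero    x∈ = x⊥̸y (ζ⇒⊥ line {x} {y} x∈ y∈line)
      pencil∉ζline (suc i) p∈ = x⊥̸y (⊥pencil⇒⊥y {x} i
        (⊥-sym {pencil (suc i)} {x} (ζ⇒⊥ line {pencil (suc i)} {x} p∈ x∈line)) (⊥-refl x))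

      abstract
        pencil≉0 : ∀ i → ¬ pencil i ≋ 0ᵛ
        pencil≉0 i p≋0 = pencil∉ζline i (zero∈ (ζ line) p≋0)

      abstract
        meets : ∀ u → ∃[ i ] u ⊥ pencil i
        meets u with Subspace.member? (ζ ⟨ u ⟩) x
        ... | yes u⊥x = zero , u⊥x
        ... | no  u⊥̸x with hyperplane {u} {x} u⊥̸x y
        ...   | k , u⊥y+kx = suc (I.to k) , Subspace.resp (ζ ⟨ u ⟩)
          (≋-trans (+ᵛ-comm y (k · x)) (+ᵛ-cong (·-congʳ (F.sym (from-to k))) (≋-refl {x = y})))
          u⊥y+kx

      -- Orthogonality to two different members of the pencil spreads to x and y, hence to the whole
      -- line.
      meets-once : ∀ {u} → u ∉ Member (ζ line) → ∀ i j → u ⊥ pencil i → u ⊥ pencil j → i ≡ j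
      meets-once u∉ zero    zero    _ _     = refl
      meets-once {u} u∉ zero    (suc j) u⊥x u⊥p = ⊥-elim (u∉ (∈ζline {u} u⊥x (⊥pencil⇒⊥y {u} j u⊥p u⊥x)))
      meets-once {u} u∉ (suc i) zero    u⊥p u⊥x = ⊥-elim (u∉ (∈ζline {u} u⊥x (⊥pencil⇒⊥y {u} i u⊥p u⊥x)))
      meets-once {u} u∉ (suc i) (suc j) u⊥p u⊥p′ with i Fin.≟ j
      ... | yes i≡j = ≡.cong suc i≡j
      ... | no  i≢j = ⊥-elim (u∉ (∈ζline {u} u⊥x (⊥pencil⇒⊥y {u} i u⊥p u⊥x)))
        where
        u⊥x : u ⊥ x
        -- Both i x + (j x + y) and j x + (i x + y) are the same vector; if u were not orthogonal to
        -- x, `coefficient` would give i = j.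
        u⊥x = decidable-stable (Subspace.member? (ζ ⟨ u ⟩) x) (λ u⊥̸x → i≢j (from-injective (proj₁
          (coefficient u {x} {I.from i} {I.from j} u⊥̸x u⊥p′ u⊥p
            (λ n → F+ˢ.x∙yz≈y∙xz (I.from i F.* x n) (I.from j F.* x n) (y n))))))

      abstract
        on-pencil : ∀ {v} → v ∈ Member line → ¬ v ≋ 0ᵛ → ∃[ i ] v ∈ Member ⟨ pencil i ⟩
        on-pencil {v} (k , v+ky∈) v≉0 with k ≟ 0#
        ... | yes k≈0 = zero , ∈-cancelʳ ⟨ x ⟩ v+ky∈ (zero∈ ⟨ x ⟩ (0·x≋0 k≈0))
        ... | no  k≉0 with v+ky∈ | inverse k k≉0
        ...   | a , v+ky≋ax | h , hk≈1 = suc i , ∈-cancelʳ ⟨ p ⟩ {v} {k · p}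
          (zero∈ ⟨ p ⟩ v+kp≋0) (Subspace.·-closed ⟨ p ⟩ k (x∈⟨x⟩ p))
          where
          i : Fin q
          -- From v + k y = a x one gets v = - k ((- a / k) x + y), and h is 1 / k.
          i = I.to (h F.* ⁻ a)
          p : V
          p = pencil (suc i)
          k·i≈-a : k F.* I.from i ≈ ⁻ a
          k·i≈-a = begin
            k F.* I.from i         ≈⟨ F.*-congˡ (from-to _) ⟩
            k F.* (h F.* ⁻ a)      ≈⟨ F.*-assoc k h (⁻ a) ⟨
            k F.* h F.* ⁻ a        ≈⟨ F.*-congʳ (F.trans (F.*-comm k h) hk≈1) ⟩
            1# F.* ⁻ a             ≈⟨ F.*-identityˡ (⁻ a) ⟩
            ⁻ a                    ∎
          v+kp≋0 : v +ᵛ k · p ≋ 0ᵛ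
          v+kp≋0 j = begin
            v j F.+ k F.* (I.from i F.* x j F.+ y j)
              ≈⟨ F.+-congˡ (F.trans (F.distribˡ k _ _) (F.+-comm _ _)) ⟩
            v j F.+ (k F.* y j F.+ k F.* (I.from i F.* x j))
              ≈⟨ F.+-assoc _ _ _ ⟨
            v j F.+ k F.* y j F.+ k F.* (I.from i F.* x j)
              ≈⟨ F.+-cong (v+ky≋ax j) (F.trans (F.sym (F.*-assoc _ _ _)) (F.*-congʳ k·i≈-a)) ⟩
            a F.* x j F.+ ⁻ a F.* x j
              ≈⟨ F.distribʳ (x j) a (⁻ a) ⟨
            (a F.+ ⁻ a) F.* x j
              ≈⟨ F.*-congʳ (F.-‿inverseʳ a) ⟩
            0# F.* x j
              ≈⟨ F.zeroˡ (x j) ⟩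
            0# ∎

      -- A non-zero common vector would be proportional to a member of the pencil, and none of these
      -- lies in `ζ line`.
      line∩ζline : ∀ {v} → v ∈ Member line → v ∈ Member (ζ line) → v ≋ 0ᵛ
      line∩ζline {v} v∈ v∈ζ = decidable-stable (v ≟ᵛ 0ᵛ) (λ v≉0 →
        let i , v∈⟨p⟩ = on-pencil v∈ v≉0 in
        pencil∉ζline i (⟨⟩≤ (ζ line) v∈ζ (∈⟨⟩-sym v≉0 v∈⟨p⟩)))

    -- Pairs of mutually polar lines

    open HyperbolicPair using (line)

    -- V has q ^ 4 vectors, but a line has only q ^ 2 pairs of coefficients.
    line-proper : 1 ℕ.< q → ∀ {x y} (x⊥̸y : ¬ x ⊥ y) → ¬ (∀ v → v ∈ Member (line x⊥̸y))
    line-proper 1<q {x} {y} x⊥̸y full = ℕ.<⇒≱ (ℕ.^-monoʳ-< q 1<q {2} {4} (s≤s (s≤s (s≤s z≤n))))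
      (≡.subst (q ℕ.^ 4 ℕ.≤_) (≡.cong (q ℕ.*_) (≡.sym (ℕ.*-identityʳ q)))
        (Fin.injective⇒≤ {f = coefficients} injective))
      where
      k a : V → F.Carrier
      k v = proj₁ (full v)
      a v = proj₁ (proj₂ (full v))

      coefficients : Fin (q ℕ.^ 4) → Fin (q ℕ.* q)
      coefficients n = combine (I.to (k (vec n))) (I.to (a (vec n)))

      to-injective : ∀ {k l} → I.to k ≡ I.to l → k ≈ l
      to-injective {k} {l} eq = F.trans (F.sym (from-to k)) (I.inverseʳ eq)

      injective : Injective _≡_ _≡_ coefficients
      injective {m} {n} eq with Fin.combine-injective _ _ _ _ eq
      ... | k≡ , a≡ = vec-injective (λ i → F+.∙-cancelʳ (k (vec m) F.* y i) _ _ (begin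
        vec m i F.+ k (vec m) F.* y i   ≈⟨ proj₂ (proj₂ (full (vec m))) i ⟩
        a (vec m) F.* x i               ≈⟨ F.*-congʳ (to-injective a≡) ⟩
        a (vec n) F.* x i               ≈⟨ proj₂ (proj₂ (full (vec n))) i ⟨
        vec n i F.+ k (vec n) F.* y i   ≈⟨ F.+-congˡ (F.*-congʳ (to-injective k≡)) ⟨
        vec n i F.+ k (vec m) F.* y i   ∎))

    -- Only relations between the four generators are stored; that the two lines are each other's
    -- polars is derived from them by counting.
    record PolarLines : Set (c ⊔ ℓ₁) where
      field
        {x y x′ y′} : V
        x⊥̸y         : ¬ x ⊥ y
        x′⊥̸y′       : ¬ x′ ⊥ y′
        x⊥x′        : x ⊥ x′
        x⊥y′        : x ⊥ y′
        y⊥x′        : y ⊥ x′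
        y⊥y′        : y ⊥ y′

      module L  = HyperbolicPair x⊥̸y
      module L′ = HyperbolicPair x′⊥̸y′

      -- The argument is a tuple of four coefficients, which makes this a self-map of V and turns
      -- independence into spanning. The trailing `0ᵛ` gives the last summand the shape that
      -- `coefficient` expects.
      combination : V → V
      combination k = k 0F · x +ᵛ (k 1F · y +ᵛ (k 2F · x′ +ᵛ (k 3F · y′ +ᵛ 0ᵛ)))

      private
        ⊥+ : ∀ z k {v w} → z ⊥ v → z ⊥ w → z ⊥ k · v +ᵛ w
        ⊥+ z k z⊥v z⊥w = Subspace.+-closed (ζ ⟨ z ⟩) (Subspace.·-closed (ζ ⟨ z ⟩) k z⊥v) z⊥w

        ⊥0 : ∀ z → z ⊥ 0ᵛ
        ⊥0 z = Subspace.0-closed (ζ ⟨ z ⟩)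

        ⊥rest′ : ∀ z k l → z ⊥ x′ → z ⊥ y′ → z ⊥ k · x′ +ᵛ (l · y′ +ᵛ 0ᵛ)
        ⊥rest′ z k l z⊥x′ z⊥y′ = ⊥+ z k z⊥x′ (⊥+ z l z⊥y′ (⊥0 z))

        y⊥rest : ∀ (k : V) → y ⊥ k 1F · y +ᵛ (k 2F · x′ +ᵛ (k 3F · y′ +ᵛ 0ᵛ))
        y⊥rest k = ⊥+ y (k 1F) (⊥-refl y) (⊥rest′ y (k 2F) (k 3F) y⊥x′ y⊥y′)

        x⊥rest : ∀ (k : V) → x ⊥ k 2F · x′ +ᵛ (k 3F · y′ +ᵛ 0ᵛ)
        x⊥rest k = ⊥rest′ x (k 2F) (k 3F) x⊥x′ x⊥y′

      -- Each coefficient is read off with the partner of its vector: y is orthogonal to y, x′ and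
      -- y′ but not to x, and the other three vectors are treated likewise.
      combination-injective : ∀ {k l} → combination k ≋ combination l → k ≋ l
      combination-injective {k} {l} eq
        with coefficient y {x} L.y⊥̸x (y⊥rest k) (y⊥rest l) eq
      ... | k₀≈ , eq₁ with coefficient x {y} x⊥̸y (x⊥rest k) (x⊥rest l) eq₁
      ... | k₁≈ , eq₂ with coefficient y′ {x′} L′.y⊥̸x
                             (⊥+ y′ (k 3F) (⊥-refl y′) (⊥0 y′)) (⊥+ y′ (l 3F) (⊥-refl y′) (⊥0 y′)) eq₂
      ... | k₂≈ , eq₃ with coefficient x′ {y′} x′⊥̸y′ (⊥0 x′) (⊥0 x′) eq₃
      ... | k₃≈ , _ = λ { 0F → k₀≈ ; 1F → k₁≈ ; 2F → k₂≈ ; 3F → k₃≈ }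

      -- An injective self-map of the finite set V is surjective.
      abstract
        combination-surjective : ∀ v → ∃[ k ] combination k ≋ v
        combination-surjective v with injective⇒surjective {f = code ∘ combination ∘ vec}
          (λ {m} {n} eq → vec-injective {m} {n} (combination-injective {vec m} {vec n}
            (code-injective {combination (vec m)} {combination (vec n)} eq))) (code v)
        ... | n , eq = vec n , code-injective {combination (vec n)} {v} eq

      -- For v in ζ L.line, pairing with y and x kills the coefficients of x and y.
      ζline≤line′ : ζ L.line ≤ˢ L′.line
      ζline≤line′ {v} v∈ζ = Subspace.resp L′.line (≋-sym (proj₂ v≋)) rest∈
        where
        k : V
        k = proj₁ (combination-surjective v)

        rest : V
        rest = k 2F · x′ +ᵛ (k 3F · y′ +ᵛ 0ᵛ)

        line⊥v : ∀ {z} → z ∈ Member L.line → z ⊥ v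
        line⊥v {z} z∈ = ⊥-sym {v} {z} (ζ⇒⊥ L.line {v} {z} v∈ζ z∈)

        0·z+v≋v : ∀ z → 0# · z +ᵛ v ≋ v
        0·z+v≋v z i = F.trans (F.+-congʳ (F.zeroˡ (z i))) (F.+-identityˡ (v i))

        v≋′ : 0# ≈ k 0F × v ≋ k 1F · y +ᵛ rest
        v≋′ = coefficient y {x} {0#} {k 0F} L.y⊥̸x (line⊥v L.y∈line) (y⊥rest k)
          (≋-trans (0·z+v≋v x) (≋-sym (proj₂ (combination-surjective v))))

        v≋ : 0# ≈ k 1F × v ≋ rest
        v≋ = coefficient x {y} {0#} {k 1F} x⊥̸y (line⊥v L.x∈line) (x⊥rest k)
          (≋-trans (0·z+v≋v y) (proj₂ v≋′))

        rest∈ : rest ∈ Member L′.line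
        rest∈ = Subspace.+-closed L′.line (Subspace.·-closed L′.line (k 2F) L′.x∈line)
          (Subspace.+-closed L′.line (Subspace.·-closed L′.line (k 3F) L′.y∈line)
            (Subspace.0-closed L′.line))

      line′≤ζline : L′.line ≤ˢ ζ L.line
      line′≤ζline = L′.line≤ (ζ L.line)
        (L.∈ζline {x′} (⊥-sym {x} {x′} x⊥x′) (⊥-sym {y} {x′} y⊥x′))
        (L.∈ζline {y′} (⊥-sym {x} {y′} x⊥y′) (⊥-sym {y} {y′} y⊥y′))

      -- Applying ζ to an inclusion already proved and cancelling ζ ζ exchanges the roles of the
      -- lines.
      line≤ζline′ : L.line ≤ˢ ζ L′.line
      line≤ζline′ v∈ = reversing {L′.line} {ζ L.line} line′≤ζline (proj₂ (involutive L.line) v∈)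

      ζline′≤line : ζ L′.line ≤ˢ L.line
      ζline′≤line v∈ = proj₁ (involutive L.line) (reversing {ζ L.line} {L′.line} ζline≤line′ v∈)

    ones≉0 : ¬ (λ _ → 1#) ≋ 0ᵛ
    ones≉0 eq = 1≉0 (eq 0F)

    non-orthogonal : ∀ {u} → ¬ u ≋ 0ᵛ → ∃[ v ] ¬ u ⊥ v
    non-orthogonal {u} u≉0 with ≤ˢ-or-outside (ζ ⟨ 0ᵛ ⟩) (ζ ⟨ u ⟩)
    ... | inj₁ ≤ζu           = ⊥-elim (u≉0 (nondegenerate (λ v → ≤ζu (0⊥ {0ᵛ} {v} ≋-refl))))
    ... | inj₂ (v , _ , u⊥̸v) = v , u⊥̸v

    module _ {x y} (x⊥̸y : ¬ x ⊥ y) where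
      open HyperbolicPair x⊥̸y using (line∩ζline) renaming (line to ℓ)

      -- If ζ ℓ were zero, ℓ would be the whole space, against `line-proper`.
      nonzero∈ζline : 1 ℕ.< q → ∃[ v ] (v ∈ Member (ζ ℓ) × ¬ v ≋ 0ᵛ)
      nonzero∈ζline 1<q with ≤ˢ-or-outside (ζ ℓ) ⟨ 0ᵛ ⟩
      ... | inj₁ ζℓ≤0 = ⊥-elim (line-proper 1<q x⊥̸y (ζ-trivial⇒full ℓ λ w∈ →
        let k , w≋k0 = ζℓ≤0 w∈ in ≋-trans w≋k0 (λ i → F.zeroʳ k)))
      ... | inj₂ (v , v∈ , v∉0) = v , v∈ , λ v≋0 → v∉0 (zero∈ ⟨ 0ᵛ ⟩ v≋0)

      -- A vector u of ζ ℓ orthogonal to all of ζ ℓ lies in ζ ζ ℓ = ℓ as well, and ℓ meets ζ ℓ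
      -- trivially.
      non-orthogonal∈ζline : ∀ {u} → u ∈ Member (ζ ℓ) → ¬ u ≋ 0ᵛ → ∃[ v ] (v ∈ Member (ζ ℓ) × ¬ u ⊥ v)
      non-orthogonal∈ζline {u} u∈ u≉0 with ≤ˢ-or-outside (ζ ℓ) (ζ ⟨ u ⟩)
      ... | inj₁ ζℓ≤ζu   = ⊥-elim (u≉0 (line∩ζline
        (proj₁ (involutive ℓ) (∈ζ (ζ ℓ) {u} ζℓ≤ζu)) u∈))
      ... | inj₂ outside = outside

    abstract
      polarLines : 1 ℕ.< q → PolarLines
      polarLines 1<q = from-x (non-orthogonal ones≉0)
        where
        from-x : ∀ {x} → ∃[ y ] ¬ x ⊥ y → PolarLines
        from-x {x} (y , x⊥̸y) with nonzero∈ζline x⊥̸y 1<q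
        ... | x′ , x′∈ , x′≉0 with non-orthogonal∈ζline x⊥̸y {x′} x′∈ x′≉0
        ... | y′ , y′∈ , x′⊥̸y′ = record
          { x = x ; y = y ; x′ = x′ ; y′ = y′ ; x⊥̸y = x⊥̸y ; x′⊥̸y′ = x′⊥̸y′
          ; x⊥x′ = ℓ⊥ζℓ {x} {x′} x∈line x′∈ ; x⊥y′ = ℓ⊥ζℓ {x} {y′} x∈line y′∈
          ; y⊥x′ = ℓ⊥ζℓ {y} {x′} y∈line x′∈ ; y⊥y′ = ℓ⊥ζℓ {y} {y′} y∈line y′∈
          }
          where
          open HyperbolicPair x⊥̸y renaming (line to ℓ)
          ℓ⊥ζℓ : ∀ {u v} → u ∈ Member ℓ → v ∈ Member (ζ ℓ) → u ⊥ v
          ℓ⊥ζℓ {u} {v} u∈ v∈ = ⊥-sym {v} {u} (ζ⇒⊥ ℓ {v} {u} v∈ u∈)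

prime-power>1 : ∀ {q} → IsPrimePower q → 1 ℕ.< q
prime-power>1 (p , k , p-prime , 1≤k , refl) = ℕ.<-≤-trans 1<p
  (≡.subst (ℕ._≤ p ℕ.^ k) (ℕ.*-identityʳ p) (ℕ.^-monoʳ-≤ p {{ℕ.>-nonZero (ℕ.<⇒≤ 1<p)}} 1≤k))
  where
  1<p : 1 ℕ.< p
  1<p = ℕ.nonTrivial⇒n>1 p {{prime⇒nonTrivial p-prime}}

-- The eigenfunction

module SymplecticGraph {c ℓ₁ ℓ₂} (F : HeytingField c ℓ₁ ℓ₂) {q : ℕ} (order : FiniteFieldOfOrder F q)
    (P : PG3.Polarity F order) (symplectic : PG3.IsSymplectic F order P) where
  open PG3 F order
  open Geometry F order
  open Symplectic P symplectic
  open Polarity P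
  open Graph (Sp4 P) using (_~_; ~-resp)
  open Setoid points using (_≈_) renaming (sym to ≈-sym; trans to ≈-trans)
  open Membership points using () renaming (_∈_ to _∈ₗ_)

  ∈⟨⟩⇒≈ : ∀ {u v} → coords u ∈ Member (span v) → u ≈ v
  ∈⟨⟩⇒≈ {u} {v} u∈ = ⟨⟩≤ (span v) u∈ , ⟨⟩≤ (span u) (∈⟨⟩-sym (nonzero u) u∈)

  on-resp : ∀ U → (_on U) Respects _≈_
  on-resp U {u} {v} (_ , v≤u) u∈ = ⟨⟩≤ U u∈ (v≤u (x∈⟨x⟩ (coords v)))

  _≟ₚ_ : Decidable₂ _≈_
  u ≟ₚ v = map′ (∈⟨⟩⇒≈ {u} {v}) (λ (u≤v , _) → u≤v (x∈⟨x⟩ (coords u)))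
    (Subspace.member? (span v) (coords u))

  _~?_ : Decidable₂ _~_
  u ~? v = ¬? (u ≟ₚ v) ×-dec Subspace.member? (ζ (span u)) (coords v)

  -- The zero vector is sent to an arbitrary point.
  pointAt : V → Point
  pointAt v with v ≟ᵛ 0ᵛ
  ... | yes _  = point _ ones≉0
  ... | no v≉0 = point v v≉0

  pointAt-cong : ∀ {v} u → coords u ≋ v → u ≈ pointAt v
  pointAt-cong {v} u u≋v with v ≟ᵛ 0ᵛ
  ... | yes v≋0 = ⊥-elim (nonzero u (≋-trans u≋v v≋0))
  ... | no  v≉0 = ∈⟨⟩⇒≈ {u} {point v v≉0} (Subspace.resp ⟨ v ⟩ (≋-sym u≋v) (x∈⟨x⟩ v))

  -- Proportional vectors give the same point, hence the deduplication. The list supplies the zero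
  -- terms of the neighbour sums.
  allPoints : List Point
  allPoints = deduplicate _≟ₚ_ (tabulate (pointAt ∘ vec))

  allPoints! : Uniqueness.Unique points allPoints
  allPoints! = DecUnique.deduplicate-!
    (record { isDecEquivalence = record
      { isEquivalence = Setoid.isEquivalence points ; _≟_ = _≟ₚ_ } })
    (tabulate (pointAt ∘ vec))

  ∈-allPoints : ∀ u → u ∈ₗ allPoints
  ∈-allPoints u = ∈ₗ.∈-deduplicate⁺ points _≟ₚ_
    (λ {u} {v} {w} w≈v u≈v → ≈-trans {u} {v} {w} u≈v (≈-sym {w} {v} w≈v))
    {tabulate (pointAt ∘ vec)} {u}
    (Any.tabulate⁺ (code (coords u)) (pointAt-cong u (≋-sym (vec-code (coords u)))))

  -- Points of a line orthogonal to a given point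

  module LinePoints {x y : V} (x⊥̸y : ¬ x ⊥ y) where
    open HyperbolicPair x⊥̸y

    pencilPoint : Fin (ℕ.suc q) → Point
    pencilPoint i = point (pencil i) (pencil≉0 i)

    -- For u on `ζ line` every point of the line would qualify; for all other u the choice is
    -- forced, by `meet-unique`.
    meet : Point → Point
    meet u = pencilPoint (proj₁ (meets (coords u)))

    meet∈line : ∀ u → meet u on line
    meet∈line u = pencil∈line (proj₁ (meets (coords u)))

    ⊥-meet : ∀ u → coords u ⊥ coords (meet u)
    ⊥-meet u = proj₂ (meets (coords u))

    meet-unique : ∀ u v → coords u ∉ Member (ζ line) → v on line → coords u ⊥ coords v → v ≈ meet u
    meet-unique u v u∉ v∈ u⊥v with meets (coords u) | on-pencil v∈ (nonzero v)
    ... | i , u⊥pᵢ | j , v∈⟨pⱼ⟩ with meets-once u∉ i j u⊥pᵢ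
            (⟨⟩≤ (ζ (span u)) u⊥v (∈⟨⟩-sym (nonzero v) v∈⟨pⱼ⟩))
    ...   | refl = ∈⟨⟩⇒≈ {v} {pencilPoint i} v∈⟨pⱼ⟩

    abstract
      linePoints : List Point
      linePoints = tabulate pencilPoint

      linePoints-enumerates : Enumerates points (_on line) linePoints
      linePoints-enumerates =
        Unique.tabulate⁺ points {f = pencilPoint} (λ {i} {j} → injective i j) , λ v → mk⇔ (to v) (from v)
        where
        injective : ∀ i j → pencilPoint i ≈ pencilPoint j → i ≡ j
        -- `meets-once` is applied to `pencil i` itself, which is orthogonal to itself and, if the
        -- points coincide, to `pencil j`.
        injective i j (_ , pⱼ≤pᵢ) = meets-once (pencil∉ζline i) i j (⊥-refl (pencil i))
          (⟨⟩≤ (ζ ⟨ pencil i ⟩) (⊥-refl (pencil i)) (pⱼ≤pᵢ (x∈⟨x⟩ (pencil j))))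

        to : ∀ v → v ∈ₗ linePoints → v on line
        to v v∈ with Any.tabulate⁻ {f = pencilPoint} v∈
        ... | i , v≈p = on-resp line {pencilPoint i} {v} (≈-sym {v} {pencilPoint i} v≈p) (pencil∈line i)

        from : ∀ v → v on line → v ∈ₗ linePoints
        from v v∈ with on-pencil v∈ (nonzero v)
        ... | i , v∈⟨p⟩ = Any.tabulate⁺ {f = pencilPoint} i (∈⟨⟩⇒≈ {v} {pencilPoint i} v∈⟨p⟩)

      length-linePoints : length linePoints ≡ q + 1
      length-linePoints = ≡.trans (List.length-tabulate pencilPoint) (ℕ.+-comm 1 q)

  module _ {x y x′ y′} (x⊥̸y : ¬ x ⊥ y) (x′⊥̸y′ : ¬ x′ ⊥ y′) where
    private
      module L   = HyperbolicPair x⊥̸y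
      module L′  = HyperbolicPair x′⊥̸y′
      module Pt  = LinePoints x⊥̸y
      module Pt′ = LinePoints x′⊥̸y′

    lines-disjoint : L′.line ≤ˢ ζ L.line → ∀ u → u on L.line → ¬ u on L′.line
    lines-disjoint line′≤ζline u u∈ u∈′ = nonzero u (L.line∩ζline u∈ (line′≤ζline u∈′))

    -- Stated for two arbitrary pairs so that it serves both lines of the support, with the roles
    -- exchanged.
    neighbours-on-line : L′.line ≤ˢ ζ L.line → ∀ u → u on L.line →
      Enumerates points (λ v → u ~ v × (v on L.line ⊎ v on L′.line)) Pt′.linePoints
    neighbours-on-line line′≤ζline u u∈ = proj₁ Pt′.linePoints-enumerates , λ v →
      mk⇔ (to v ∘ Equivalence.to (proj₂ Pt′.linePoints-enumerates v))
          (Equivalence.from (proj₂ Pt′.linePoints-enumerates v) ∘ from v)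
      where
      to : ∀ v → v on L′.line → u ~ v × (v on L.line ⊎ v on L′.line)
      to v v∈′ =
          ( (λ u≈v → lines-disjoint line′≤ζline v (on-resp L.line {u} {v} u≈v u∈) v∈′)
          , ⊥-sym {coords v} {coords u} (ζ⇒⊥ L.line {coords v} {coords u} (line′≤ζline v∈′) u∈))
        , inj₂ v∈′

      from : ∀ v → u ~ v × (v on L.line ⊎ v on L′.line) → v on L′.line
      from v (_ , inj₂ v∈′) = v∈′
      -- As u is orthogonal to itself, u and v would both be the unique point of `L.line` orthogonal
      -- to u.
      from v ((u≉v , u⊥v) , inj₁ v∈) = ⊥-elim (u≉v
        (≈-trans {u} {Pt.meet u} {v} (Pt.meet-unique u u u∉ u∈ (⊥-refl (coords u)))
          (≈-sym {v} {Pt.meet u} (Pt.meet-unique u v u∉ v∈ u⊥v))))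
        where
        u∉ : coords u ∉ Member (ζ L.line)
        u∉ u∈ζ = nonzero u (L.line∩ζline u∈ u∈ζ)

  module Eigenfunction (lines : PolarLines) where
    open PolarLines lines
    module Pt  = LinePoints x⊥̸y
    module Pt′ = LinePoints x′⊥̸y′

    Support : Point → Set _
    Support u = u on L.line ⊎ u on L′.line

    disjoint : ∀ {u} → u on L.line → ¬ u on L′.line
    disjoint {u} = lines-disjoint x⊥̸y x′⊥̸y′ line′≤ζline u

    neighbours-line : ∀ u → u on L.line →
      Enumerates points (λ v → u ~ v × Support v) Pt′.linePoints
    neighbours-line = neighbours-on-line x⊥̸y x′⊥̸y′ line′≤ζline

    neighbours-line′ : ∀ u → u on L′.line →
      Enumerates points (λ v → u ~ v × Support v) Pt.linePoints
    neighbours-line′ u u∈′ = proj₁ swapped , λ v →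
      mk⇔ (λ v∈ → map₂ Sum.swap (Equivalence.to (proj₂ swapped v) v∈))
          (λ v∈S → Equivalence.from (proj₂ swapped v) (map₂ Sum.swap v∈S))
      where
      swapped : Enumerates points (λ v → u ~ v × (v on L′.line ⊎ v on L.line)) Pt.linePoints
      swapped = neighbours-on-line x′⊥̸y′ x⊥̸y line≤ζline′ u u∈′

    -- Uniqueness on one line needs u outside its polar, which is the other line. The two points
    -- found carry opposite values.
    neighbours-off : ∀ {u} → ¬ u on L.line → ¬ u on L′.line →
      Enumerates points (λ v → u ~ v × Support v) (Pt.meet u ∷ Pt′.meet u ∷ [])
    neighbours-off {u} u∉ u∉′ = ((p≉p′ ∷ []) ∷ ([] ∷ [])) , λ v → mk⇔ (to v) (from v)
      where
      p p′ : Point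
      p  = Pt.meet u
      p′ = Pt′.meet u

      p∈ : p on L.line
      p∈ = Pt.meet∈line u

      p′∈ : p′ on L′.line
      p′∈ = Pt′.meet∈line u

      p≉p′ : ¬ p ≈ p′
      p≉p′ p≈p′ = disjoint {p′} (on-resp L.line {p} {p′} p≈p′ p∈) p′∈

      S-resp : ∀ {v w} → v ≈ w → u ~ v × Support v → u ~ w × Support w
      S-resp {v} {w} v≈w (u~v , v∈) = proj₁ ~-resp {u} {v} {w} v≈w u~v
        , Sum.map (on-resp L.line {v} {w} v≈w) (on-resp L′.line {v} {w} v≈w) v∈

      to : ∀ v → v ∈ₗ p ∷ p′ ∷ [] → u ~ v × Support v
      to v (here v≈p) = S-resp {p} {v} (≈-sym {v} {p} v≈p)
        (((λ u≈p → u∉ (on-resp L.line {p} {u} (≈-sym {u} {p} u≈p) p∈))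
        , Pt.⊥-meet u) , inj₁ p∈)
      to v (there (here v≈p′)) = S-resp {p′} {v} (≈-sym {v} {p′} v≈p′)
        (((λ u≈p′ → u∉′ (on-resp L′.line {p′} {u} (≈-sym {u} {p′} u≈p′) p′∈))
        , Pt′.⊥-meet u) , inj₂ p′∈)

      from : ∀ v → u ~ v × Support v → v ∈ₗ p ∷ p′ ∷ []
      from v ((_ , u⊥v) , inj₁ v∈) =
        here (Pt.meet-unique u v (u∉′ ∘ ζline≤line′) v∈ u⊥v)
      from v ((_ , u⊥v) , inj₂ v∈′) =
        there (here (Pt′.meet-unique u v (u∉ ∘ ζline′≤line) v∈′ u⊥v))

    on-line? : ∀ u → Dec (u on L.line)
    on-line? u = Subspace.member? L.line (coords u)

    on-line′? : ∀ u → Dec (u on L′.line)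
    on-line′? u = Subspace.member? L′.line (coords u)

    abstract
      value : Point → ℤ
      value u with on-line? u | on-line′? u
      ... | yes _ | _     = 1ℤ
      ... | no _  | yes _ = -1ℤ
      ... | no _  | no _  = 0ℤ

      value-line : ∀ u → u on L.line → value u ≡ 1ℤ
      value-line u u∈ with on-line? u | on-line′? u
      ... | yes _ | _ = refl
      ... | no u∉ | _ = ⊥-elim (u∉ u∈)

      value-line′ : ∀ u → u on L′.line → value u ≡ -1ℤ
      value-line′ u u∈′ with on-line? u | on-line′? u
      ... | yes u∈ | _      = ⊥-elim (disjoint {u} u∈ u∈′)
      ... | no _   | yes _  = refl
      ... | no _   | no u∉′ = ⊥-elim (u∉′ u∈′)

      value-off : ∀ u → ¬ Support u → value u ≡ 0ℤ
      value-off u u∉ with on-line? u | on-line′? u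
      ... | yes u∈ | _       = ⊥-elim (u∉ (inj₁ u∈))
      ... | no _   | yes u∈′ = ⊥-elim (u∉ (inj₂ u∈′))
      ... | no _   | no _    = refl

    support? : Decidable Support
    support? u = on-line? u ⊎-dec on-line′? u

    support-resp : Support Respects _≈_
    support-resp {u} {v} u≈v = Sum.map (on-resp L.line {u} {v} u≈v) (on-resp L′.line {u} {v} u≈v)

    value-cong : ∀ {u v} → u ≈ v → value u ≡ value v
    value-cong {u} {v} u≈v = cases (support? u)
      where
      cases : Dec (Support u) → value u ≡ value v
      cases (yes (inj₁ u∈))  = ≡.trans (value-line u u∈)
                             (≡.sym (value-line v (on-resp L.line {u} {v} u≈v u∈)))
      cases (yes (inj₂ u∈′)) = ≡.trans (value-line′ u u∈′)
                             (≡.sym (value-line′ v (on-resp L′.line {u} {v} u≈v u∈′)))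
      cases (no u∉)          = ≡.trans (value-off u u∉)
                             (≡.sym (value-off v (u∉ ∘ support-resp {v} {u} (≈-sym {u} {v} u≈v))))

    f : VertexFunction (Sp4 P)
    f = record { to = fromℤ ∘ value ; cong = fromℤ-cong ∘ value-cong }

    θ : ℤ
    θ = - (+ (q + 1))

    -- Reduces the eigenvalue equation at u to an integer sum over the neighbours in the support.
    hasSum : ∀ u {ns} → Enumerates points (λ v → u ~ v × Support v) ns →
             sumᶻ (map value ns) ≡ θ ℤ.* value u →
             HasSum points (u ~_) f (fromℤ θ *ʳ Func.to f u)
    hasSum u {ns} ns-enum eq = proj₁ total , proj₁ (proj₂ total) ,
      Setoid.trans ℝ-setoid {s} {fromℤ (θ ℤ.* value u)} {fromℤ θ *ʳ fromℤ (value u)}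
        (Setoid.trans ℝ-setoid {s} {fromℤ (sumᶻ (map value ns))} {fromℤ (θ ℤ.* value u)}
          (proj₂ (proj₂ total)) (fromℤ-cong eq))
        (Setoid.sym ℝ-setoid {fromℤ θ *ʳ fromℤ (value u)} {fromℤ (θ ℤ.* value u)}
          (fromℤ-homo-* θ (value u)))
      where
      total : HasSum points (u ~_) f (fromℤ (sumᶻ (map value ns)))
      total = hasSum-extend points {P = u ~_} {Q = Support} (u ~?_)
        (λ {v} {w} → proj₁ ~-resp {u} {v} {w}) support? (λ {v} {w} → support-resp {v} {w})
        allPoints! ∈-allPoints f value (λ _ → refl) value-off ns-enum

      s : ℝ
      s = sumʳ (map (Func.to f) (proj₁ total))

    all-line : All (λ v → value v ≡ 1ℤ) Pt.linePoints
    all-line = All.tabulateₛ points (λ {v} v∈ →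
      value-line v (Equivalence.to (proj₂ Pt.linePoints-enumerates v) v∈))

    all-line′ : All (λ v → value v ≡ -1ℤ) Pt′.linePoints
    all-line′ = All.tabulateₛ points (λ {v} v∈ →
      value-line′ v (Equivalence.to (proj₂ Pt′.linePoints-enumerates v) v∈))

    eigen : ∀ u → HasSum points (u ~_) f (fromℤ θ *ʳ Func.to f u)
    eigen u = cases (support? u)
      where
      cases : Dec (Support u) → HasSum points (u ~_) f (fromℤ θ *ʳ Func.to f u)
      cases (yes (inj₁ u∈)) = hasSum u (neighbours-line u u∈) (begin
        sumᶻ (map value Pt′.linePoints)   ≡⟨ sum-const value -1ℤ all-line′ ⟩
        + length Pt′.linePoints ℤ.* -1ℤ   ≡⟨ cong (λ n → + n ℤ.* -1ℤ) Pt′.length-linePoints ⟩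
        + (q + 1) ℤ.* -1ℤ                 ≡⟨ ℤ.*-comm (+ (q + 1)) -1ℤ ⟩
        -1ℤ ℤ.* + (q + 1)                 ≡⟨ ℤ.-1*i≡-i (+ (q + 1)) ⟩
        θ                                 ≡⟨ ℤ.*-identityʳ θ ⟨
        θ ℤ.* 1ℤ                          ≡⟨ cong (θ ℤ.*_) (value-line u u∈) ⟨
        θ ℤ.* value u                     ∎)
        where open ≡.≡-Reasoning
      cases (yes (inj₂ u∈′)) = hasSum u (neighbours-line′ u u∈′) (begin
        sumᶻ (map value Pt.linePoints)    ≡⟨ sum-const value 1ℤ all-line ⟩
        + length Pt.linePoints ℤ.* 1ℤ     ≡⟨ cong (λ n → + n ℤ.* 1ℤ) Pt.length-linePoints ⟩
        + (q + 1) ℤ.* 1ℤ                  ≡⟨ ℤ.neg-distribʳ-* (+ (q + 1)) -1ℤ ⟨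
        - (+ (q + 1) ℤ.* -1ℤ)             ≡⟨ ℤ.neg-distribˡ-* (+ (q + 1)) -1ℤ ⟩
        θ ℤ.* -1ℤ                         ≡⟨ cong (θ ℤ.*_) (value-line′ u u∈′) ⟨
        θ ℤ.* value u                     ∎)
        where open ≡.≡-Reasoning
      cases (no u∉) = hasSum u (neighbours-off {u} (u∉ ∘ inj₁) (u∉ ∘ inj₂)) (begin
        value p ℤ.+ (value p′ ℤ.+ 0ℤ)
          ≡⟨ ≡.cong₂ (λ i j → i ℤ.+ (j ℤ.+ 0ℤ)) (value-line p (Pt.meet∈line u))
               (value-line′ p′ (Pt′.meet∈line u)) ⟩
        0ℤ                                ≡⟨ ℤ.*-zeroʳ θ ⟨
        θ ℤ.* 0ℤ                          ≡⟨ cong (θ ℤ.*_) (value-off u u∉) ⟨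
        θ ℤ.* value u                     ∎)
        where
        open ≡.≡-Reasoning
        p p′ : Point
        p  = Pt.meet u
        p′ = Pt′.meet u

    nonzero⇔support : ∀ u → (¬ Func.to f u ≈ʳ 0ʳ) ⇔ Support u
    nonzero⇔support u = mk⇔ to from
      where
      to : ¬ Func.to f u ≈ʳ 0ʳ → Support u
      to fu≉0 = decidable-stable (support? u) (λ u∉ → fu≉0 (fromℤ-cong (value-off u u∉)))

      from : Support u → ¬ Func.to f u ≈ʳ 0ʳ
      from (inj₁ u∈)  = ≡.subst (λ i → ¬ fromℤ i ≈ʳ 0ʳ) (≡.sym (value-line u u∈)) 1ʳ≉0
      from (inj₂ u∈′) = ≡.subst (λ i → ¬ fromℤ i ≈ʳ 0ʳ) (≡.sym (value-line′ u u∈′)) -1ʳ≉0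

    isEigenfunction : IsEigenfunction (Sp4 P) (fromℤ θ) f
    isEigenfunction = (λ f≈0 → Equivalence.from (nonzero⇔support p) (inj₁ L.x∈line) (f≈0 p)) , eigen
      where
      p : Point
      p = Pt.pencilPoint zero

    hasNonZeroes : HasNonZeroes (Sp4 P) f (2 * (q + 1))
    hasNonZeroes = Pt.linePoints ++ Pt′.linePoints
      , (Unique.++⁺ points (proj₁ Pt.linePoints-enumerates) (proj₁ Pt′.linePoints-enumerates)
          (λ {v} (v∈ , v∈′) → disjoint {v} (on-line v v∈) (on-line′ v v∈′))
        , λ v → mk⇔ (to v) (from v))
      , (begin
          length (Pt.linePoints ++ Pt′.linePoints)        ≡⟨ List.length-++ Pt.linePoints ⟩
          length Pt.linePoints + length Pt′.linePoints
            ≡⟨ ≡.cong₂ _+_ Pt.length-linePoints Pt′.length-linePoints ⟩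
          (q + 1) + (q + 1)                               ≡⟨ cong (λ n → q + 1 + n) (ℕ.+-identityʳ (q + 1)) ⟨
          2 * (q + 1)                                     ∎)
      where
      open ≡.≡-Reasoning
      on-line : ∀ v → v ∈ₗ Pt.linePoints → v on L.line
      on-line v = Equivalence.to (proj₂ Pt.linePoints-enumerates v)
      on-line′ : ∀ v → v ∈ₗ Pt′.linePoints → v on L′.line
      on-line′ v = Equivalence.to (proj₂ Pt′.linePoints-enumerates v)

      to : ∀ v → v ∈ₗ Pt.linePoints ++ Pt′.linePoints → ¬ Func.to f v ≈ʳ 0ʳ
      to v v∈ = Equivalence.from (nonzero⇔support v)
        (Sum.map (on-line v) (on-line′ v) (∈ₗ.∈-++⁻ points {v = v} Pt.linePoints v∈))

      from : ∀ v → ¬ Func.to f v ≈ʳ 0ʳ → v ∈ₗ Pt.linePoints ++ Pt′.linePoints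
      from v fv≉0 with Equivalence.to (nonzero⇔support v) fv≉0
      ... | inj₁ v∈  = ∈ₗ.∈-++⁺ˡ points {v = v} (Equivalence.from (proj₂ Pt.linePoints-enumerates v) v∈)
      ... | inj₂ v∈′ = ∈ₗ.∈-++⁺ʳ points {v = v} Pt.linePoints
                         (Equivalence.from (proj₂ Pt′.linePoints-enumerates v) v∈′)

theorem8 : ∀ {c ℓ₁ ℓ₂} (q : ℕ) → IsPrimePower q →
    (F : HeytingField c ℓ₁ ℓ₂) (order : FiniteFieldOfOrder F q) →
    let open PG3 F order in
    (P : Polarity) → IsSymplectic P →
    ∃[ f ] (IsEigenfunction (Sp4 P) (fromℤ (- (+ (q + 1)))) f
    × HasNonZeroes (Sp4 P) f (2 * (q + 1)))
theorem8 q q-primePower F order P symplectic = f , isEigenfunction , hasNonZeroes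
  where
  open SymplecticGraph F order P symplectic
  open Geometry F order
  open Symplectic P symplectic
  open Eigenfunction (polarLines (prime-power>1 q-primePower))
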